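{- Let $\mathfrak{L}$ be a logic and $T$ a theory which is consistent in $\mathfrak{L}$ and Rosser in $\mathfrak{L}$. Then $T$ is essentially undecidable in $\mathfrak{L}$.
   Context: Abstract setting: a countable set of formulas $Fm$ (with a fixed effective coding) containing a distinguished subset of "$\Sigma_1$-formulas", and for each $\Sigma_1$-formula $\varphi$ a distinguished formula $\neg\varphi$. A logic $\mathfrak{L}$ is a relation $\vdash_\mathfrak{L}\subseteq\wp(Fm)\times Fm$ satisfying reflexivity ($\Gamma\cup\{\varphi\}\vdash_\mathfrak{L}\varphi$) and cut (if $\Gamma\vdash_\mathfrak{L}\varphi$ and $\Delta\vdash_\mathfrak{L}\gamma$ for all $\gamma\in\Gamma$, then $\Delta\vdash_\mathfrak{L}\varphi$). A theory is a set of formulas; $C_\mathfrak{L}(T)=\{\varphi\mid T\vdash_\mathfrak{L}\varphi\}$. $T$ is decidable in $\mathfrak{L}$ iff $C_\mathfrak{L}(T)$ is recursive; $S$ strengthens $T$ iff $T\subseteq C_\mathfrak{L}(S)$; $T$ is consistent in $\mathfrak{L}$ iff no $\Sigma_1$-formula $\varphi$ has $T\vdash_\mathfrak{L}\varphi$ and $T\vdash_\mathfrak{L}\neg\varphi$; $T$ is essentially undecidable in $\mathfrak{L}$ iff it is consistent and each consistent theory strengthening it is undecidable. $T$ is Rosser in $\mathfrak{L}$ if for every pair of disjoint recursively enumerable sets $A,B\subseteq\mathbb{N}$ there is a recursive sequence of $\Sigma_1$-formulas $(\varphi_n)_n$ such that $n\in A$ implies $T\vdash_\mathfrak{L}\varphi_n$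 and $n\in B$ implies $T\vdash_\mathfrak{L}\neg\varphi_n$. -}

module Defs where

open import Level using (0ℓ)
open import Data.Nat using (ℕ; zero; suc; _<_)
open import Data.Fin using (Fin)
open import Data.Vec using (Vec; []; _∷_; lookup)
open import Data.Product using (Σ; _×_; ∃; _,_)
open import Data.Sum using (_⊎_)
open import Data.Empty using (⊥)
open import Relation.Nullary using (¬_)
open import Relation.Unary using (Pred)
open import Relation.Binary.PropositionalEquality using (_≡_)
open import Function.Definitions using (Injective)

data PRCode : ℕ → Set where
  zer  : ∀ {n} → PRCode n
  succ : PRCode 1
  proj : ∀ {n} → Fin n → PRCode n
  comp : ∀ {m n} → PRCode m → Vec (PRCode n) m → PRCode n
  prec : ∀ {n} → PRCode n → PRCode (suc (suc n)) → PRCode (suc n)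
  mu   : ∀ {n} → PRCode (suc n) → PRCode n

-- Big-step semantics: Eval f xs y  means  f(xs) is defined and equals y.
mutual
  data Eval : ∀ {n} → PRCode n → Vec ℕ n → ℕ → Set where
    e-zer  : ∀ {n} {xs : Vec ℕ n} → Eval zer xs 0
    e-succ : ∀ {x} → Eval succ (x ∷ []) (suc x)
    e-proj : ∀ {n} {i : Fin n} {xs} → Eval (proj i) xs (lookup xs i)
    e-comp : ∀ {m n} {f : PRCode m} {gs : Vec (PRCode n) m} {xs ys y} →
             EvalAll gs xs ys → Eval f ys y → Eval (comp f gs) xs y
    e-prec-zero : ∀ {n} {g : PRCode n} {h} {xs y} →
             Eval g xs y → Eval (prec g h) (zero ∷ xs) y
    e-prec-suc  : ∀ {n} {g : PRCode n} {h} {xs k r y} →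
             Eval (prec g h) (k ∷ xs) r → Eval h (k ∷ r ∷ xs) y →
             Eval (prec g h) (suc k ∷ xs) y
    e-mu   : ∀ {n} {f : PRCode (suc n)} {xs y} →
             Eval f (y ∷ xs) 0 →
             (∀ z → z < y → Σ ℕ λ w → Eval f (z ∷ xs) (suc w)) →
             Eval (mu f) xs y

  data EvalAll : ∀ {m n} → Vec (PRCode n) m → Vec ℕ n → Vec ℕ m → Set where
    []  : ∀ {n} {xs : Vec ℕ n} → EvalAll [] xs []
    _∷_ : ∀ {m n} {g : PRCode n} {gs : Vec (PRCode n) m} {xs y ys} →
          Eval g xs y → EvalAll gs xs ys → EvalAll (g ∷ gs) xs (y ∷ ys)

Recursive : Pred ℕ 0ℓ → Set
Recursive A = Σ (PRCode 1) λ f →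
  ∀ x → (A x × Eval f (x ∷ []) 1) ⊎ (¬ A x × Eval f (x ∷ []) 0)

RE : Pred ℕ 0ℓ → Set
RE A = Σ (PRCode 1) λ f → ∀ x → (A x → ∃ λ y → Eval f (x ∷ []) y)
                               × ((∃ λ y → Eval f (x ∷ []) y) → A x)

RecursiveFun : (ℕ → ℕ) → Set
RecursiveFun g = Σ (PRCode 1) λ f → ∀ x → Eval f (x ∷ []) (g x)

record Language : Set₁ where
  field
    Fm     : Set
    ⌜_⌝    : Fm → ℕ
    ⌜⌝-inj : Injective _≡_ _≡_ ⌜_⌝
    Σ₁     : Pred Fm 0ℓ
    neg    : (φ : Fm) → Σ₁ φ → Fm

module _ (𝓛 : Language) where
  open Language 𝓛

  Theory : Set₁
  Theory = Pred Fm 0ℓ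

  record Logic : Set₁ where
    field
      _⊢_  : Theory → Fm → Set
      refl : ∀ (Γ : Theory) φ → Γ φ → Γ ⊢ φ
      cut  : ∀ (Γ Δ : Theory) φ → Γ ⊢ φ → (∀ γ → Γ γ → Δ ⊢ γ) → Δ ⊢ φ

  module _ (𝔏 : Logic) where
    open Logic 𝔏

    CodesOfConsequences : Theory → Pred ℕ 0ℓ
    CodesOfConsequences T k = ∃ λ φ → ⌜ φ ⌝ ≡ k × T ⊢ φ

    DecidableIn : Theory → Set
    DecidableIn T = Recursive (CodesOfConsequences T)

    Strengthens : Theory → Theory → Set
    Strengthens S T = ∀ φ → T φ → S ⊢ φ

    ConsistentIn : Theory → Set
    ConsistentIn T = ¬ (Σ Fm λ φ → Σ (Σ₁ φ) λ s → (T ⊢ φ) × (T ⊢ neg φ s))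

    EssentiallyUndecidableIn : Theory → Set₁
    EssentiallyUndecidableIn T =
      ConsistentIn T × (∀ (S : Theory) → Strengthens S T → ConsistentIn S → ¬ DecidableIn S)

    RosserIn : Theory → Set₁
    RosserIn T = ∀ (A B : Pred ℕ 0ℓ) → RE A → RE B → (∀ n → A n → B n → ⊥) →
      Σ (ℕ → Fm) λ φ → Σ (∀ n → Σ₁ (φ n)) λ σ →
        RecursiveFun (λ n → ⌜ φ n ⌝)
        × (∀ n → A n → T ⊢ φ n)
        × (∀ n → B n → T ⊢ neg (φ n) (σ n))

-- Take the two diagonal halting
-- sets H₀, H₁: the numbers e such that program number e, run on input e, halts
-- with output 0, resp. 1.  They are disjoint and r.e., so the Rosser property
-- gives a recursive sequence of Σ₁-sentences φₙ with T ⊢ φₙ on H₀ and T ⊢ ¬φₙ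
-- on H₁.  For a consistent decidable S strengthening T, the set {n | S ⊢ φₙ}
-- would be recursive, contain H₀ and avoid H₁; running its decision procedure
-- on its own number shows that no such set exists.

module Submission where

open import Defs
open import Level using (0ℓ)
open import Data.Nat using (ℕ; zero; suc; _+_; _∸_; _<_; _≤_; z≤n; s≤s; pred; ≢-nonZero)
open import Data.Nat.Properties
open import Data.Fin using (Fin; toℕ; #_) renaming (zero to fz; suc to fs)
open import Data.Vec using (Vec; []; _∷_; lookup)
open import Data.List using (List; []; _∷_; _++_)
open import Data.List.Properties using (++-identityʳ; ++-assoc)
open import Data.Product using (Σ; _×_; ∃; _,_; proj₁; proj₂)
open import Data.Sum using (inj₁; inj₂)
import Data.Sum as Sum
import Data.Product as Product
open import Data.Empty using (⊥; ⊥-elim)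
open import Relation.Nullary using (¬_; yes; no)
open import Relation.Binary.PropositionalEquality
open import Relation.Binary.Definitions using (tri<; tri≈; tri>)
open import Relation.Unary using (Pred; Decidable)
open import Data.Nat.Induction using (<-rec)

record Fun (n : ℕ) : Set where
  field
    fn       : Vec ℕ n → ℕ
    code     : PRCode n
    computes : ∀ xs → Eval code xs (fn xs)
open Fun public

withGraph : ∀ {n} (F : Fun n) (g : Vec ℕ n → ℕ) → (∀ xs → fn F xs ≡ g xs) → Fun n
withGraph F g F≗g = record
  { fn = g ; code = code F ; computes = λ xs → subst (Eval (code F) xs) (F≗g xs) (computes F xs) }

constCode : ∀ {n} → ℕ → PRCode n
constCode zero    = zer
constCode (suc c) = comp succ (constCode c ∷ [])

constCode-computes : ∀ {n} c (xs : Vec ℕ n) → Eval (constCode c) xs c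
constCode-computes zero    xs = e-zer
constCode-computes (suc c) xs = e-comp (constCode-computes c xs ∷ []) e-succ

data Term (n : ℕ) : Set where
  var : Fin n → Term n
  lit : ℕ → Term n
  app : ∀ {m} → Fun m → Vec (Term n) m → Term n

mutual
  ⟦_⟧ : ∀ {n} → Term n → Vec ℕ n → ℕ
  ⟦ var i ⟧    xs = lookup xs i
  ⟦ lit c ⟧    xs = c
  ⟦ app F ts ⟧ xs = fn F (⟦ ts ⟧* xs)

  ⟦_⟧* : ∀ {n m} → Vec (Term n) m → Vec ℕ n → Vec ℕ m
  ⟦ [] ⟧*     xs = []
  ⟦ t ∷ ts ⟧* xs = ⟦ t ⟧ xs ∷ ⟦ ts ⟧* xs

mutual
  compile : ∀ {n} → Term n → PRCode n
  compile (var i)    = proj i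
  compile (lit c)    = constCode c
  compile (app F ts) = comp (code F) (compile* ts)

  compile* : ∀ {n m} → Vec (Term n) m → Vec (PRCode n) m
  compile* []       = []
  compile* (t ∷ ts) = compile t ∷ compile* ts

mutual
  compile-computes : ∀ {n} (t : Term n) xs → Eval (compile t) xs (⟦ t ⟧ xs)
  compile-computes (var i)    xs = e-proj
  compile-computes (lit c)    xs = constCode-computes c xs
  compile-computes (app F ts) xs = e-comp (compile*-computes ts xs) (computes F _)

  compile*-computes : ∀ {n m} (ts : Vec (Term n) m) xs → EvalAll (compile* ts) xs (⟦ ts ⟧* xs)
  compile*-computes []       xs = []
  compile*-computes (t ∷ ts) xs = compile-computes t xs ∷ compile*-computes ts xs

termFun : ∀ {n} → Term n → Fun n
termFun t = record { fn = ⟦ t ⟧ ; code = compile t ; computes = compile-computes t }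

app₁ : ∀ {n} → Fun 1 → Term n → Term n
app₁ F a = app F (a ∷ [])

app₂ : ∀ {n} → Fun 2 → Term n → Term n → Term n
app₂ F a b = app F (a ∷ b ∷ [])

app₃ : ∀ {n} → Fun 3 → Term n → Term n → Term n → Term n
app₃ F a b c = app F (a ∷ b ∷ c ∷ [])

recGraph : ∀ {n} → Fun n → Fun (suc (suc n)) → Vec ℕ (suc n) → ℕ
recGraph g h (zero  ∷ xs) = fn g xs
recGraph g h (suc k ∷ xs) = fn h (k ∷ recGraph g h (k ∷ xs) ∷ xs)

recGraph-computes : ∀ {n} (g : Fun n) (h : Fun (suc (suc n))) xs →
                    Eval (prec (code g) (code h)) xs (recGraph g h xs)
recGraph-computes g h (zero  ∷ xs) = e-prec-zero (computes g xs)
recGraph-computes g h (suc k ∷ xs) = e-prec-suc (recGraph-computes g h (k ∷ xs)) (computes h _)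

recFun : ∀ {n} → Fun n → Fun (suc (suc n)) → Fun (suc n)
recFun g h = record { fn = recGraph g h ; code = prec (code g) (code h) ; computes = recGraph-computes g h }

zeroF : ∀ {n} → Fun n
zeroF = record { fn = λ _ → 0 ; code = zer ; computes = λ _ → e-zer }

sucF : Fun 1
sucF = record { fn = λ { (x ∷ []) → suc x } ; code = succ ; computes = λ { (x ∷ []) → e-succ } }

addF : Fun 2
addF = withGraph adder (λ { (a ∷ b ∷ []) → a + b }) λ { (a ∷ b ∷ []) → graph a b }
  where
  adder : Fun 2
  adder = recFun (termFun (var (# 0))) (termFun (app₁ sucF (var (# 1))))

  graph : ∀ a b → fn adder (a ∷ b ∷ []) ≡ a + b
  graph zero    b = refl
  graph (suc a) b = cong suc (graph a b)

predF : Fun 1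
predF = withGraph (recFun zeroF (termFun (var (# 0)))) (λ { (a ∷ []) → pred a }) λ { (zero ∷ []) → refl ; (suc a ∷ []) → refl }

-- Truncated subtraction, by recursion on the subtrahend.
monusF : Fun 2
monusF = withGraph (termFun (app₂ flipped (var (# 1)) (var (# 0)))) (λ { (a ∷ b ∷ []) → a ∸ b }) λ { (a ∷ b ∷ []) → graph a b }
  where
  flipped : Fun 2
  flipped = recFun (termFun (var (# 0))) (termFun (app₁ predF (var (# 1))))

  graph : ∀ a b → fn flipped (b ∷ a ∷ []) ≡ a ∸ b
  graph a zero    = refl
  graph a (suc b) = trans (cong pred (graph a b)) (pred[m∸n]≡m∸[1+n] a b)

ifz : ℕ → ℕ → ℕ → ℕ
ifz zero    a b = a
ifz (suc _) a b = b

ifz-nonzero : ∀ {c a b} → c ≢ 0 → ifz c a b ≡ b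
ifz-nonzero {zero}  c≢0 = ⊥-elim (c≢0 refl)
ifz-nonzero {suc c} c≢0 = refl

ifzF : Fun 3
ifzF = withGraph (recFun (termFun (var (# 0))) (termFun (var (# 3)))) (λ { (c ∷ a ∷ b ∷ []) → ifz c a b })
                 λ { (zero ∷ a ∷ b ∷ []) → refl ; (suc c ∷ a ∷ b ∷ []) → refl }

-- dist a b is 0 exactly when a ≡ b; it turns equality tests into zero tests.
dist : ℕ → ℕ → ℕ
dist a b = (a ∸ b) + (b ∸ a)

dist-self : ∀ a → dist a a ≡ 0
dist-self a rewrite n∸n≡0 a = refl

dist≡0⇒≡ : ∀ {a b} → dist a b ≡ 0 → a ≡ b
dist≡0⇒≡ {a} {b} d≡0 = ≤-antisym (m∸n≡0⇒m≤n (m+n≡0⇒m≡0 _ d≡0)) (m∸n≡0⇒m≤n (m+n≡0⇒n≡0 (a ∸ b) d≡0))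

-- Cantor pairing  pair a b = tri (a + b) + b,  with tri n = 0 + 1 + ⋯ + n.
-- It is inverted through  row p, the n with  tri n ≤ p < tri (n + 1),
-- which is computed by primitive recursion on p.

tri : ℕ → ℕ
tri zero    = 0
tri (suc n) = tri n + suc n

triF : Fun 1
triF = withGraph summer (λ { (n ∷ []) → tri n }) λ { (n ∷ []) → graph n }
  where
  summer : Fun 1
  summer = recFun zeroF (termFun (app₂ addF (var (# 1)) (app₁ sucF (var (# 0)))))

  graph : ∀ n → fn summer (n ∷ []) ≡ tri n
  graph zero    = refl
  graph (suc n) = cong (_+ suc n) (graph n)

tri-mono : ∀ {n m} → n < m → tri (suc n) ≤ tri m
tri-mono {n} {suc m} (s≤s n≤m) with m≤n⇒m<n∨m≡n n≤m
... | inj₂ refl = ≤-refl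
... | inj₁ n<m  = ≤-trans (tri-mono n<m) (m≤m+n (tri m) (suc m))

-- Moving from p to p + 1, the row index advances exactly when p + 1 reaches
-- the next triangular number.
row : ℕ → ℕ
row zero    = 0
row (suc p) = ifz (tri (suc (row p)) ∸ suc p) (suc (row p)) (row p)

rowF : Fun 1
rowF = withGraph counter (λ { (p ∷ []) → row p }) λ { (p ∷ []) → graph p }
  where
  next : Term 2   -- (p , row p) ↦ row (p + 1)
  next = app₃ ifzF (app₂ monusF (app₁ triF (app₁ sucF (var (# 1)))) (app₁ sucF (var (# 0))))
                   (app₁ sucF (var (# 1))) (var (# 1))

  counter : Fun 1
  counter = recFun zeroF (termFun next)

  graph : ∀ p → fn counter (p ∷ []) ≡ row p
  graph zero    = refl
  graph (suc p) = cong (λ r → ifz (tri (suc r) ∸ suc p) (suc r) r) (graph p)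

row-bounds : ∀ p → tri (row p) ≤ p × p < tri (suc (row p))
row-bounds zero = z≤n , s≤s z≤n
row-bounds (suc p) with tri (suc (row p)) ∸ suc p in eq
... | zero  = m∸n≡0⇒m≤n eq , (begin-strict
                suc p                               ≤⟨ proj₂ (row-bounds p) ⟩
                tri (suc (row p))                   <⟨ m<m+n _ (s≤s z≤n) ⟩
                tri (suc (row p)) + suc (suc (row p)) ∎)
  where open ≤-Reasoning
... | suc _ = ≤-trans (proj₁ (row-bounds p)) (n≤1+n p) , m∸n≢0⇒n<m (λ e → 0≢1+n (trans (sym e) eq))

row-unique : ∀ n p → tri n ≤ p → p < tri (suc n) → row p ≡ n
row-unique n p lower upper with <-cmp (row p) n
... | tri≈ _ row≡n _ = row≡n
... | tri< row<n _ _ = ⊥-elim (<-irrefl refl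
        (<-≤-trans (proj₂ (row-bounds p)) (≤-trans (tri-mono row<n) lower)))
... | tri> _ _ n<row = ⊥-elim (<-irrefl refl
        (<-≤-trans upper (≤-trans (tri-mono n<row) (proj₁ (row-bounds p)))))

-- Kept opaque so that codes built from pairs are never unfolded during checking;
-- the *-unfold equations expose the definitions where the functions are compiled.
opaque
  pair : ℕ → ℕ → ℕ
  pair a b = tri (a + b) + b

  unpair₂ : ℕ → ℕ
  unpair₂ p = p ∸ tri (row p)

  unpair₁ : ℕ → ℕ
  unpair₁ p = row p ∸ unpair₂ p

  pair-unfold : ∀ a b → tri (a + b) + b ≡ pair a b
  pair-unfold a b = refl

  unpair₂-unfold : ∀ p → p ∸ tri (row p) ≡ unpair₂ p
  unpair₂-unfold p = refl

  unpair₁-unfold : ∀ p → row p ∸ unpair₂ p ≡ unpair₁ p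
  unpair₁-unfold p = refl

  row-pair : ∀ a b → row (pair a b) ≡ a + b
  row-pair a b = row-unique (a + b) (tri (a + b) + b) (m≤m+n _ _)
                   (+-monoʳ-< (tri (a + b)) (s≤s (m≤n+m b a)))

  unpair₂-pair : ∀ a b → unpair₂ (pair a b) ≡ b
  unpair₂-pair a b rewrite row-pair a b = m+n∸m≡n (tri (a + b)) b

  unpair₁-pair : ∀ a b → unpair₁ (pair a b) ≡ a
  unpair₁-pair a b rewrite unpair₂-pair a b | row-pair a b = m+n∸n≡m a b

pairF : Fun 2
pairF = withGraph (termFun (app₂ addF (app₁ triF (app₂ addF (var (# 0)) (var (# 1)))) (var (# 1))))
                  (λ { (a ∷ b ∷ []) → pair a b }) λ { (a ∷ b ∷ []) → pair-unfold a b }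

unpair₂F : Fun 1
unpair₂F = withGraph (termFun (app₂ monusF (var (# 0)) (app₁ triF (app₁ rowF (var (# 0))))))
                     (λ { (p ∷ []) → unpair₂ p }) λ { (p ∷ []) → unpair₂-unfold p }

unpair₁F : Fun 1
unpair₁F = withGraph (termFun (app₂ monusF (app₁ rowF (var (# 0))) (app₁ unpair₂F (var (# 0)))))
                     (λ { (p ∷ []) → unpair₁ p }) λ { (p ∷ []) → unpair₁-unfold p }

pair-injective₂ : ∀ {a b c d} → pair a b ≡ pair c d → b ≡ d
pair-injective₂ {a} {b} {c} {d} eq = trans (sym (unpair₂-pair a b)) (trans (cong unpair₂ eq) (unpair₂-pair c d))

unpair₁₂-pair : ∀ a b c → unpair₁ (unpair₂ (pair a (pair b c))) ≡ b
unpair₁₂-pair a b c = trans (cong unpair₁ (unpair₂-pair a (pair b c))) (unpair₁-pair b c)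

unpair₂₂-pair : ∀ a b c → unpair₂ (unpair₂ (pair a (pair b c))) ≡ c
unpair₂₂-pair a b c = trans (cong unpair₂ (unpair₂-pair a (pair b c))) (unpair₂-pair b c)

-- Lists of numbers: the empty list is 0 and  a ∷ l  is  pair a l + 1.

cons : ℕ → ℕ → ℕ
cons a l = suc (pair a l)

hd tl : ℕ → ℕ
hd l = unpair₁ (pred l)
tl l = unpair₂ (pred l)

hd-cons : ∀ a l → hd (cons a l) ≡ a
hd-cons = unpair₁-pair

tl-cons : ∀ a l → tl (cons a l) ≡ l
tl-cons = unpair₂-pair

encList : List ℕ → ℕ
encList []      = 0
encList (a ∷ l) = cons a (encList l)

prepend : ∀ {m} → Vec ℕ m → ℕ → ℕ
prepend []       l = l
prepend (x ∷ xs) l = cons x (prepend xs l)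

encVec : ∀ {m} → Vec ℕ m → ℕ
encVec xs = prepend xs 0

drop : ℕ → ℕ → ℕ
drop zero    l = l
drop (suc k) l = tl (drop k l)

dropF : Fun 2
dropF = withGraph dropper (λ { (k ∷ l ∷ []) → drop k l }) λ { (k ∷ l ∷ []) → graph k l }
  where
  dropper : Fun 2
  dropper = recFun (termFun (var (# 0))) (termFun (app₁ unpair₂F (app₁ predF (var (# 1)))))

  graph : ∀ k l → fn dropper (k ∷ l ∷ []) ≡ drop k l
  graph zero    l = refl
  graph (suc k) l = cong tl (graph k l)

drop-suc : ∀ k l → drop (suc k) l ≡ drop k (tl l)
drop-suc zero    l = refl
drop-suc (suc k) l = cong tl (drop-suc k l)

nth : ℕ → ℕ → ℕ
nth k l = hd (drop k l)

nth-encVec : ∀ {n} (i : Fin n) (xs : Vec ℕ n) → nth (toℕ i) (encVec xs) ≡ lookup xs i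
nth-encVec fz     (x ∷ xs) = hd-cons x _
nth-encVec (fs i) (x ∷ xs) = begin
  hd (drop (suc (toℕ i)) (cons x (encVec xs))) ≡⟨ cong hd (drop-suc (toℕ i) _) ⟩
  hd (drop (toℕ i) (tl (cons x (encVec xs))))  ≡⟨ cong (λ l → nth (toℕ i) l) (tl-cons x _) ⟩
  nth (toℕ i) (encVec xs)                      ≡⟨ nth-encVec i xs ⟩
  lookup xs i                                  ∎
  where open ≡-Reasoning

-- The argument codes of  comp f gs  are listed last-to-first, because the
-- machine conses each computed argument onto an accumulator list.
mutual
  enc : ∀ {n} → PRCode n → ℕ
  enc zer         = pair 0 0
  enc succ        = pair 1 0
  enc (proj i)    = pair 2 (toℕ i)
  enc (comp f gs) = pair 3 (pair (enc f) (encList (argCodes gs)))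
  enc (prec g h)  = pair 4 (pair (enc g) (enc h))
  enc (mu f)      = pair 5 (enc f)

  argCodes : ∀ {n m} → Vec (PRCode n) m → List ℕ
  argCodes []       = []
  argCodes (g ∷ gs) = argCodes gs ++ (enc g ∷ [])

pairᵗ : ∀ {n} → Term n → Term n → Term n
pairᵗ = app₂ pairF

fstᵗ sndᵗ sucᵗ predᵗ hdᵗ tlᵗ : ∀ {n} → Term n → Term n
fstᵗ  = app₁ unpair₁F
sndᵗ  = app₁ unpair₂F
sucᵗ  = app₁ sucF
predᵗ = app₁ predF
hdᵗ l = fstᵗ (predᵗ l)
tlᵗ l = sndᵗ (predᵗ l)

consᵗ monusᵗ distᵗ nthᵗ : ∀ {n} → Term n → Term n → Term n
consᵗ a l   = sucᵗ (pairᵗ a l)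
monusᵗ      = app₂ monusF
distᵗ a b   = app₂ addF (monusᵗ a b) (monusᵗ b a)
nthᵗ k l    = hdᵗ (app₂ dropF k l)

ifzᵗ : ∀ {n} → Term n → Term n → Term n → Term n
ifzᵗ = app₃ ifzF

-- A state is one of
--   evalState c xs K : run the program numbered c on the argument list xs,
--   retState  y K    : hand the value y to the top frame of the stack K,
--   haltState y      : finished with result y,
-- where the stack K is a list of frames
--   argsFrame f L xs acc : inside  comp f gs  on xs; L are the argument codes still
--                          to run, acc the argument values found so far (reversed),
--   precFrame h i N xs   : inside  prec g h  on (N ∷ xs); the returned value is the
--                          i-th iterate,
--   muFrame f z xs       : inside  mu f  on xs; the returned value is f(z ∷ xs).

evalState : ℕ → ℕ → ℕ → ℕ
evalState c xs K = pair 0 (pair c (pair xs K))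

retState : ℕ → ℕ → ℕ
retState y K = pair 1 (pair y K)

haltState : ℕ → ℕ
haltState y = pair 2 y

argsFrame precFrame : ℕ → ℕ → ℕ → ℕ → ℕ
argsFrame f L xs acc = pair 0 (pair f (pair L (pair xs acc)))
precFrame h i N xs   = pair 1 (pair h (pair i (pair N xs)))

muFrame : ℕ → ℕ → ℕ → ℕ
muFrame f z xs = pair 2 (pair f (pair z xs))

evalStateᵗ : ∀ {n} → Term n → Term n → Term n → Term n
evalStateᵗ c xs K = pairᵗ (lit 0) (pairᵗ c (pairᵗ xs K))

retStateᵗ : ∀ {n} → Term n → Term n → Term n
retStateᵗ y K = pairᵗ (lit 1) (pairᵗ y K)

haltStateᵗ : ∀ {n} → Term n → Term n
haltStateᵗ y = pairᵗ (lit 2) y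

argsFrameᵗ precFrameᵗ : ∀ {n} → Term n → Term n → Term n → Term n → Term n
argsFrameᵗ f L xs acc = pairᵗ (lit 0) (pairᵗ f (pairᵗ L (pairᵗ xs acc)))
precFrameᵗ h i N xs   = pairᵗ (lit 1) (pairᵗ h (pairᵗ i (pairᵗ N xs)))

muFrameᵗ : ∀ {n} → Term n → Term n → Term n → Term n
muFrameᵗ f z xs = pairᵗ (lit 2) (pairᵗ f (pairᵗ z xs))

-- The transition function, written in layers: each layer decodes one level of
-- the state and dispatches on a tag.  A primed layer receives the fields of a
-- frame separately, the unprimed one the packed frame.

-- (y , f , z , xs , K): a zero value ends the search at z, otherwise try z + 1.
muReturn′F : Fun 5
muReturn′F = termFun (ifzᵗ (var (# 0)) (retStateᵗ (var (# 2)) (var (# 4)))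
  (evalStateᵗ (var (# 1)) (consᵗ (sucᵗ (var (# 2))) (var (# 3)))
              (consᵗ (muFrameᵗ (var (# 1)) (sucᵗ (var (# 2))) (var (# 3))) (var (# 4)))))

muReturnF : Fun 4
muReturnF = termFun (app muReturn′F
  (var (# 0) ∷ var (# 1) ∷ fstᵗ (var (# 2)) ∷ sndᵗ (var (# 2)) ∷ var (# 3) ∷ []))

-- (y , h , i , N , xs , K): at i = N the iteration is complete, otherwise apply h.
precReturn′F : Fun 6
precReturn′F = termFun (ifzᵗ (distᵗ (var (# 2)) (var (# 3))) (retStateᵗ (var (# 0)) (var (# 5)))
  (evalStateᵗ (var (# 1)) (consᵗ (var (# 2)) (consᵗ (var (# 0)) (var (# 4))))
              (consᵗ (precFrameᵗ (var (# 1)) (sucᵗ (var (# 2))) (var (# 3)) (var (# 4))) (var (# 5)))))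

precReturnF : Fun 4
precReturnF = termFun (app precReturn′F (var (# 0) ∷ var (# 1) ∷ fstᵗ (var (# 2))
  ∷ fstᵗ (sndᵗ (var (# 2))) ∷ sndᵗ (sndᵗ (var (# 2))) ∷ var (# 3) ∷ []))

-- (y , f , L , xs , acc , K): store y; run the next argument code, or f once none is left.
argsReturn′F : Fun 6
argsReturn′F = termFun (ifzᵗ (var (# 2))
  (evalStateᵗ (var (# 1)) (consᵗ (var (# 0)) (var (# 4))) (var (# 5)))
  (evalStateᵗ (hdᵗ (var (# 2))) (var (# 3))
    (consᵗ (argsFrameᵗ (var (# 1)) (tlᵗ (var (# 2))) (var (# 3)) (consᵗ (var (# 0)) (var (# 4))))
           (var (# 5)))))

argsReturnF : Fun 4
argsReturnF = termFun (app argsReturn′F (var (# 0) ∷ var (# 1) ∷ fstᵗ (var (# 2))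
  ∷ fstᵗ (sndᵗ (var (# 2))) ∷ sndᵗ (sndᵗ (var (# 2))) ∷ var (# 3) ∷ []))

-- (y , frame tag , frame data , K)
frameReturn′F : Fun 4
frameReturn′F = termFun (ifzᵗ (var (# 1)) (app argsReturnF fields)
  (ifzᵗ (predᵗ (var (# 1))) (app precReturnF fields) (app muReturnF fields)))
  where
  fields : Vec (Term 4) 4
  fields = var (# 0) ∷ fstᵗ (var (# 2)) ∷ sndᵗ (var (# 2)) ∷ var (# 3) ∷ []

-- (y , frame , K)
frameReturnF : Fun 3
frameReturnF = termFun (app frameReturn′F
  (var (# 0) ∷ fstᵗ (var (# 1)) ∷ sndᵗ (var (# 1)) ∷ var (# 2) ∷ []))

-- (y , K): an empty stack means the computation is over.
returnF : Fun 2
returnF = termFun (ifzᵗ (var (# 1)) (haltStateᵗ (var (# 0)))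
  (app frameReturnF (var (# 0) ∷ hdᵗ (var (# 1)) ∷ tlᵗ (var (# 1)) ∷ [])))

-- (f , L , xs , K): start  comp f gs  by running the first argument code in L.
compStartF : Fun 4
compStartF = termFun (ifzᵗ (var (# 1)) (evalStateᵗ (var (# 0)) (lit 0) (var (# 3)))
  (evalStateᵗ (hdᵗ (var (# 1))) (var (# 2))
    (consᵗ (argsFrameᵗ (var (# 0)) (tlᵗ (var (# 1))) (var (# 2)) (lit 0)) (var (# 3)))))

-- (code tag , code data , xs , K): one case per constructor of PRCode.
eval′F : Fun 4
eval′F = termFun
  (ifzᵗ tag (retStateᵗ (lit 0) K)
  (ifzᵗ (predᵗ tag) (retStateᵗ (sucᵗ (hdᵗ xs)) K)
  (ifzᵗ (predᵗ (predᵗ tag)) (retStateᵗ (nthᵗ dat xs) K)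
  (ifzᵗ (monusᵗ tag (lit 3)) (app compStartF (fstᵗ dat ∷ sndᵗ dat ∷ xs ∷ K ∷ []))
  (ifzᵗ (monusᵗ tag (lit 4))
     (evalStateᵗ (fstᵗ dat) (tlᵗ xs) (consᵗ (precFrameᵗ (sndᵗ dat) (lit 0) (hdᵗ xs) (tlᵗ xs)) K))
     (evalStateᵗ dat (consᵗ (lit 0) xs) (consᵗ (muFrameᵗ dat (lit 0) xs) K)))))))
  where
  tag dat xs K : Term 4
  tag = var (# 0)
  dat = var (# 1)
  xs  = var (# 2)
  K   = var (# 3)

-- (c , xs , K)
evalF : Fun 3
evalF = termFun (app eval′F (fstᵗ (var (# 0)) ∷ sndᵗ (var (# 0)) ∷ var (# 1) ∷ var (# 2) ∷ []))

-- (state tag , state data)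
dispatchF : Fun 2
dispatchF = termFun (ifzᵗ (var (# 0)) (app evalF (fstᵗ s ∷ fstᵗ (sndᵗ s) ∷ sndᵗ (sndᵗ s) ∷ []))
  (ifzᵗ (predᵗ (var (# 0))) (app returnF (fstᵗ s ∷ sndᵗ s ∷ [])) (haltStateᵗ s)))
  where
  s : Term 2
  s = var (# 1)

stepF : Fun 1
stepF = termFun (app dispatchF (fstᵗ (var (# 0)) ∷ sndᵗ (var (# 0)) ∷ []))

step : ℕ → ℕ
step s = fn stepF (s ∷ [])

iterate : ℕ → ℕ → ℕ
iterate zero    s = s
iterate (suc k) s = step (iterate k s)

cong₃ : ∀ {A B C D : Set} (f : A → B → C → D) {a a′ b b′ c c′} →
        a ≡ a′ → b ≡ b′ → c ≡ c′ → f a b c ≡ f a′ b′ c′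
cong₃ f refl refl refl = refl

step-pair : ∀ t s → step (pair t s) ≡ fn dispatchF (t ∷ s ∷ [])
step-pair t s = cong₂ (λ a b → fn dispatchF (a ∷ b ∷ [])) (unpair₁-pair t s) (unpair₂-pair t s)

step-eval : ∀ t d xs K → step (evalState (pair t d) xs K) ≡ fn eval′F (t ∷ d ∷ xs ∷ K ∷ [])
step-eval t d xs K = begin
  step (evalState (pair t d) xs K)
    ≡⟨ step-pair 0 _ ⟩
  fn evalF (unpair₁ s ∷ unpair₁ (unpair₂ s) ∷ unpair₂ (unpair₂ s) ∷ [])
    ≡⟨ cong₃ (λ c a b → fn evalF (c ∷ a ∷ b ∷ [])) (unpair₁-pair (pair t d) _)
             (unpair₁₂-pair (pair t d) xs K) (unpair₂₂-pair (pair t d) xs K) ⟩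
  fn evalF (pair t d ∷ xs ∷ K ∷ [])
    ≡⟨ cong₂ (λ a b → fn eval′F (a ∷ b ∷ xs ∷ K ∷ [])) (unpair₁-pair t d) (unpair₂-pair t d) ⟩
  fn eval′F (t ∷ d ∷ xs ∷ K ∷ []) ∎
  where
  open ≡-Reasoning
  s : ℕ
  s = pair (pair t d) (pair xs K)

step-halt : ∀ y → step (haltState y) ≡ haltState y
step-halt y = step-pair 2 y

step-return : ∀ y K → step (retState y K) ≡ fn returnF (y ∷ K ∷ [])
step-return y K = trans (step-pair 1 (pair y K))
  (cong₂ (λ a b → fn returnF (a ∷ b ∷ [])) (unpair₁-pair y K) (unpair₂-pair y K))

step-return-empty : ∀ y → step (retState y 0) ≡ haltState y
step-return-empty y = step-return y 0

step-return-frame : ∀ y t d K → step (retState y (cons (pair t d) K)) ≡ fn frameReturn′F (y ∷ t ∷ d ∷ K ∷ [])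
step-return-frame y t d K = begin
  step (retState y (cons (pair t d) K))
    ≡⟨ step-return y _ ⟩
  fn frameReturnF (y ∷ hd (cons (pair t d) K) ∷ tl (cons (pair t d) K) ∷ [])
    ≡⟨ cong₂ (λ a b → fn frameReturnF (y ∷ a ∷ b ∷ [])) (hd-cons (pair t d) K) (tl-cons (pair t d) K) ⟩
  fn frameReturnF (y ∷ pair t d ∷ K ∷ [])
    ≡⟨ cong₂ (λ a b → fn frameReturn′F (y ∷ a ∷ b ∷ K ∷ [])) (unpair₁-pair t d) (unpair₂-pair t d) ⟩
  fn frameReturn′F (y ∷ t ∷ d ∷ K ∷ []) ∎
  where open ≡-Reasoning

step-args : ∀ y f L xs acc K → step (retState y (cons (argsFrame f L xs acc) K)) ≡
                                fn argsReturn′F (y ∷ f ∷ L ∷ xs ∷ acc ∷ K ∷ [])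
step-args y f L xs acc K = begin
  step (retState y (cons (argsFrame f L xs acc) K))
    ≡⟨ step-return-frame y 0 _ K ⟩
  fn argsReturnF (y ∷ unpair₁ (pair f d) ∷ unpair₂ (pair f d) ∷ K ∷ [])
    ≡⟨ cong₂ (λ a b → fn argsReturnF (y ∷ a ∷ b ∷ K ∷ [])) (unpair₁-pair f d) (unpair₂-pair f d) ⟩
  fn argsReturnF (y ∷ f ∷ d ∷ K ∷ [])
    ≡⟨ cong₃ (λ a b c → fn argsReturn′F (y ∷ f ∷ a ∷ b ∷ c ∷ K ∷ []))
             (unpair₁-pair L _) (unpair₁₂-pair L xs acc) (unpair₂₂-pair L xs acc) ⟩
  fn argsReturn′F (y ∷ f ∷ L ∷ xs ∷ acc ∷ K ∷ []) ∎
  where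
  open ≡-Reasoning
  d : ℕ
  d = pair L (pair xs acc)

step-prec-frame : ∀ y h i N xs K → step (retState y (cons (precFrame h i N xs) K)) ≡
                                   fn precReturn′F (y ∷ h ∷ i ∷ N ∷ xs ∷ K ∷ [])
step-prec-frame y h i N xs K = begin
  step (retState y (cons (precFrame h i N xs) K))
    ≡⟨ step-return-frame y 1 _ K ⟩
  fn precReturnF (y ∷ unpair₁ (pair h d) ∷ unpair₂ (pair h d) ∷ K ∷ [])
    ≡⟨ cong₂ (λ a b → fn precReturnF (y ∷ a ∷ b ∷ K ∷ [])) (unpair₁-pair h d) (unpair₂-pair h d) ⟩
  fn precReturnF (y ∷ h ∷ d ∷ K ∷ [])
    ≡⟨ cong₃ (λ a b c → fn precReturn′F (y ∷ h ∷ a ∷ b ∷ c ∷ K ∷ []))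
             (unpair₁-pair i _) (unpair₁₂-pair i N xs) (unpair₂₂-pair i N xs) ⟩
  fn precReturn′F (y ∷ h ∷ i ∷ N ∷ xs ∷ K ∷ []) ∎
  where
  open ≡-Reasoning
  d : ℕ
  d = pair i (pair N xs)

step-mu-frame : ∀ y f z xs K → step (retState y (cons (muFrame f z xs) K)) ≡
                               fn muReturn′F (y ∷ f ∷ z ∷ xs ∷ K ∷ [])
step-mu-frame y f z xs K = begin
  step (retState y (cons (muFrame f z xs) K))
    ≡⟨ step-return-frame y 2 _ K ⟩
  fn muReturnF (y ∷ unpair₁ (pair f d) ∷ unpair₂ (pair f d) ∷ K ∷ [])
    ≡⟨ cong₂ (λ a b → fn muReturnF (y ∷ a ∷ b ∷ K ∷ [])) (unpair₁-pair f d) (unpair₂-pair f d) ⟩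
  fn muReturnF (y ∷ f ∷ d ∷ K ∷ [])
    ≡⟨ cong₂ (λ a b → fn muReturn′F (y ∷ f ∷ a ∷ b ∷ K ∷ [])) (unpair₁-pair z xs) (unpair₂-pair z xs) ⟩
  fn muReturn′F (y ∷ f ∷ z ∷ xs ∷ K ∷ []) ∎
  where
  open ≡-Reasoning
  d : ℕ
  d = pair z xs

step-zer : ∀ {n} xs K → step (evalState (enc (zer {n})) xs K) ≡ retState 0 K
step-zer xs K = step-eval 0 0 xs K

step-succ : ∀ x K → step (evalState (enc succ) (encVec (x ∷ [])) K) ≡ retState (suc x) K
step-succ x K = trans (step-eval 1 0 _ K) (cong (λ v → retState (suc v) K) (hd-cons x 0))

step-proj : ∀ {n} (i : Fin n) xs K → step (evalState (enc (proj i)) (encVec xs) K) ≡ retState (lookup xs i) K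
step-proj i xs K = trans (step-eval 2 (toℕ i) _ K) (cong (λ v → retState v K) (nth-encVec i xs))

-- Composition: the argument codes L are run one after the other on xs.
argsLoop : ℕ → ℕ → ℕ → List ℕ → ℕ → ℕ
argsLoop f xs K []      acc = evalState f acc K
argsLoop f xs K (g ∷ L) acc = evalState g xs (cons (argsFrame f (encList L) xs acc) K)

step-comp : ∀ {m n} (f : PRCode m) (gs : Vec (PRCode n) m) xs K →
            step (evalState (enc (comp f gs)) xs K) ≡ argsLoop (enc f) xs K (argCodes gs) 0
step-comp f gs xs K = begin
  step (evalState (enc (comp f gs)) xs K)
    ≡⟨ step-eval 3 _ xs K ⟩
  fn compStartF (unpair₁ (pair (enc f) args) ∷ unpair₂ (pair (enc f) args) ∷ xs ∷ K ∷ [])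
    ≡⟨ cong₂ (λ a b → fn compStartF (a ∷ b ∷ xs ∷ K ∷ [])) (unpair₁-pair (enc f) args) (unpair₂-pair (enc f) args) ⟩
  fn compStartF (enc f ∷ args ∷ xs ∷ K ∷ [])
    ≡⟨ run-first (argCodes gs) ⟩
  argsLoop (enc f) xs K (argCodes gs) 0 ∎
  where
  open ≡-Reasoning
  args : ℕ
  args = encList (argCodes gs)

  run-first : ∀ L → fn compStartF (enc f ∷ encList L ∷ xs ∷ K ∷ []) ≡ argsLoop (enc f) xs K L 0
  run-first []      = refl
  run-first (g ∷ L) = cong₂ (λ a b → evalState a xs (cons (argsFrame (enc f) b xs 0) K)) (hd-cons g _) (tl-cons g _)

step-args-next : ∀ y f L xs acc K →
                 step (retState y (cons (argsFrame f (encList L) xs acc) K)) ≡ argsLoop f xs K L (cons y acc)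
step-args-next y f L xs acc K = trans (step-args y f (encList L) xs acc K) (continue L)
  where
  continue : ∀ L → fn argsReturn′F (y ∷ f ∷ encList L ∷ xs ∷ acc ∷ K ∷ []) ≡ argsLoop f xs K L (cons y acc)
  continue []      = refl
  continue (g ∷ L) = cong₂ (λ a b → evalState a xs (cons (argsFrame f b xs (cons y acc)) K)) (hd-cons g _) (tl-cons g _)

step-prec : ∀ {n} (g : PRCode n) h k xs K →
            step (evalState (enc (prec g h)) (cons k xs) K) ≡ evalState (enc g) xs (cons (precFrame (enc h) 0 k xs) K)
step-prec g h k xs K = begin
  step (evalState (enc (prec g h)) (cons k xs) K)
    ≡⟨ step-eval 4 _ _ K ⟩
  state (unpair₁ (pair (enc g) (enc h))) (unpair₂ (pair (enc g) (enc h))) (hd (cons k xs)) (tl (cons k xs))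
    ≡⟨ cong₂ (λ a b → state a b (hd (cons k xs)) (tl (cons k xs))) (unpair₁-pair (enc g) (enc h)) (unpair₂-pair (enc g) (enc h)) ⟩
  state (enc g) (enc h) (hd (cons k xs)) (tl (cons k xs))
    ≡⟨ cong₂ (state (enc g) (enc h)) (hd-cons k xs) (tl-cons k xs) ⟩
  state (enc g) (enc h) k xs ∎
  where
  open ≡-Reasoning
  state : ℕ → ℕ → ℕ → ℕ → ℕ
  state g′ h′ k′ xs′ = evalState g′ xs′ (cons (precFrame h′ 0 k′ xs′) K)

step-prec-done : ∀ y h N xs K → step (retState y (cons (precFrame h N N xs) K)) ≡ retState y K
step-prec-done y h N xs K = trans (step-prec-frame y h N N xs K) (cong (λ c → ifz c (retState y K) next) (dist-self N))
  where
  next : ℕ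
  next = evalState h (cons N (cons y xs)) (cons (precFrame h (suc N) N xs) K)

step-prec-next : ∀ y h i N xs K → i ≢ N →
                 step (retState y (cons (precFrame h i N xs) K)) ≡
                 evalState h (cons i (cons y xs)) (cons (precFrame h (suc i) N xs) K)
step-prec-next y h i N xs K i≢N =
  trans (step-prec-frame y h i N xs K) (ifz-nonzero (λ d≡0 → i≢N (dist≡0⇒≡ d≡0)))

step-mu : ∀ {n} (f : PRCode (suc n)) xs K →
          step (evalState (enc (mu f)) xs K) ≡ evalState (enc f) (cons 0 xs) (cons (muFrame (enc f) 0 xs) K)
step-mu f xs K = step-eval 5 (enc f) xs K

step-mu-found : ∀ f z xs K → step (retState 0 (cons (muFrame f z xs) K)) ≡ retState z K
step-mu-found = step-mu-frame 0

step-mu-next : ∀ w f z xs K → step (retState (suc w) (cons (muFrame f z xs) K)) ≡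
               evalState f (cons (suc z) xs) (cons (muFrame f (suc z) xs) K)
step-mu-next w = step-mu-frame (suc w)

_↠_ : ℕ → ℕ → Set
s ↠ t = ∃ λ k → iterate k s ≡ t

iterate-+ : ∀ k j s → iterate (k + j) s ≡ iterate k (iterate j s)
iterate-+ zero    j s = refl
iterate-+ (suc k) j s = cong step (iterate-+ k j s)

↠-refl : ∀ {s} → s ↠ s
↠-refl = 0 , refl

↠-step : ∀ {s t} → step s ≡ t → s ↠ t
↠-step s→t = 1 , s→t

infixr 5 _⨾_
_⨾_ : ∀ {s t u} → s ↠ t → t ↠ u → s ↠ u
_⨾_ {s} (j , s→t) (k , t→u) = k + j , trans (iterate-+ k j s) (trans (cong (iterate k) s→t) t→u)

mutual
  eval-runs : ∀ {n} {c : PRCode n} {xs y} → Eval c xs y → ∀ K →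
              evalState (enc c) (encVec xs) K ↠ retState y K
  eval-runs (e-zer {n} {xs})      K = ↠-step (step-zer {n} (encVec xs) K)
  eval-runs (e-succ {x})          K = ↠-step (step-succ x K)
  eval-runs (e-proj {i = i} {xs}) K = ↠-step (step-proj i xs K)
  eval-runs (e-comp {f = f} {gs} {xs} args ef) K =
    ↠-step (step-comp f gs (encVec xs) K)
    ⨾ subst (λ L → argsLoop (enc f) (encVec xs) K L 0 ↠ _) (++-identityʳ (argCodes gs)) (args-run f xs K args [] 0)
    ⨾ eval-runs ef K
  eval-runs d@(e-prec-zero _)     K = prec-runs d K
  eval-runs d@(e-prec-suc _ _)    K = prec-runs d K
  eval-runs (e-mu {f = f} {xs} {y} found below) K =
    ↠-step (step-mu f (encVec xs) K) ⨾ mu-search found below y 0 (+-identityʳ y) K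

  args-run : ∀ {m k n} (f : PRCode m) (xs : Vec ℕ n) K {gs : Vec (PRCode n) k} {ys} →
             EvalAll gs xs ys → ∀ R acc →
             argsLoop (enc f) (encVec xs) K (argCodes gs ++ R) acc ↠ argsLoop (enc f) (encVec xs) K R (prepend ys acc)
  args-run f xs K []                                       R acc = ↠-refl
  args-run f xs K (_∷_ {g = g} {gs = gs} {y = y} {ys = ys} eg egs) R acc =
    subst (λ L → argsLoop (enc f) (encVec xs) K L acc ↠ _) (sym (++-assoc (argCodes gs) (enc g ∷ []) R))
      (args-run f xs K egs (enc g ∷ R) acc
       ⨾ eval-runs eg _
       ⨾ ↠-step (step-args-next y (enc f) R (encVec xs) (prepend ys acc) K))

  prec-runs : ∀ {n} {g : PRCode n} {h k xs y} → Eval (prec g h) (k ∷ xs) y → ∀ K →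
              evalState (enc (prec g h)) (encVec (k ∷ xs)) K ↠ retState y K
  prec-runs {g = g} {h} {k} {xs} {y} d K =
    ↠-step (step-prec g h k (encVec xs) K)
    ⨾ prec-iterations d k ≤-refl K
    ⨾ ↠-step (step-prec-done y (enc h) k (encVec xs) K)

  prec-iterations : ∀ {n} {g : PRCode n} {h k xs r} → Eval (prec g h) (k ∷ xs) r → ∀ N → k ≤ N → ∀ K →
                    evalState (enc g) (encVec xs) (cons (precFrame (enc h) 0 N (encVec xs)) K)
                    ↠ retState r (cons (precFrame (enc h) k N (encVec xs)) K)
  prec-iterations (e-prec-zero dg) N k≤N K = eval-runs dg _
  prec-iterations {h = h} {suc k} {xs} (e-prec-suc {r = r} dk dh) N k<N K =
    prec-iterations dk N (<⇒≤ k<N) K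
    ⨾ ↠-step (step-prec-next r (enc h) k N (encVec xs) K (<⇒≢ k<N))
    ⨾ eval-runs dh _

  -- The search of  mu f  from z on, with d = y - z candidates still to reject.
  mu-search : ∀ {n} {f : PRCode (suc n)} {xs y} → Eval f (y ∷ xs) 0 →
              (∀ z → z < y → Σ ℕ λ w → Eval f (z ∷ xs) (suc w)) →
              ∀ d z → d + z ≡ y → ∀ K →
              evalState (enc f) (cons z (encVec xs)) (cons (muFrame (enc f) z (encVec xs)) K) ↠ retState y K
  mu-search {f = f} {xs} found below zero z refl K =
    eval-runs found _ ⨾ ↠-step (step-mu-found (enc f) z (encVec xs) K)
  mu-search {f = f} {xs} found below (suc d) z d+z≡y K =
    eval-runs (proj₂ (below z z<y)) _
    ⨾ ↠-step (step-mu-next _ (enc f) z (encVec xs) K)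
    ⨾ mu-search found below d (suc z) (trans (+-suc d z) d+z≡y) K
    where
    z<y : z < _
    z<y = subst (z <_) d+z≡y (s≤s (m≤n+m z d))

-- Evaluation is deterministic; it shows that a value of  mu f  is a zero of f.
mutual
  Eval-deterministic : ∀ {n} {c : PRCode n} {xs y y′} → Eval c xs y → Eval c xs y′ → y ≡ y′
  Eval-deterministic e-zer e-zer   = refl
  Eval-deterministic e-succ e-succ = refl
  Eval-deterministic e-proj e-proj = refl
  Eval-deterministic (e-comp args f) (e-comp args′ f′) with EvalAll-deterministic args args′
  ... | refl = Eval-deterministic f f′
  Eval-deterministic (e-prec-zero g) (e-prec-zero g′) = Eval-deterministic g g′
  Eval-deterministic (e-prec-suc r h) (e-prec-suc r′ h′) with Eval-deterministic r r′
  ... | refl = Eval-deterministic h h′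
  Eval-deterministic (e-mu {y = y} found below) (e-mu {y = y′} found′ below′) with <-cmp y y′
  ... | tri≈ _ y≡y′ _ = y≡y′
  ... | tri< y<y′ _ _ = ⊥-elim (0≢1+n (Eval-deterministic found (proj₂ (below′ y y<y′))))
  ... | tri> _ _ y′<y = ⊥-elim (0≢1+n (Eval-deterministic found′ (proj₂ (below y′ y′<y))))

  EvalAll-deterministic : ∀ {m n} {gs : Vec (PRCode n) m} {xs ys ys′} →
                          EvalAll gs xs ys → EvalAll gs xs ys′ → ys ≡ ys′
  EvalAll-deterministic []       []         = refl
  EvalAll-deterministic (e ∷ es) (e′ ∷ es′) = cong₂ _∷_ (Eval-deterministic e e′) (EvalAll-deterministic es es′)

least-witness : ∀ {P : Pred ℕ 0ℓ} → Decidable P → ∀ {n} → P n → ∃ λ m → P m × (∀ z → z < m → ¬ P z)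
least-witness {P} P? {n} = <-rec (λ n → P n → ∃ λ m → P m × (∀ z → z < m → ¬ P z)) search n
  where
  search : ∀ n → (∀ {z} → z < n → P z → ∃ λ m → P m × (∀ z → z < m → ¬ P z)) →
           P n → ∃ λ m → P m × (∀ z → z < m → ¬ P z)
  search n smaller Pn with anyUpTo? P? n
  ... | yes (z , z<n , Pz) = smaller z<n Pz
  ... | no  none           = n , Pn , λ z z<n Pz → none (z , z<n , Pz)

-- The projection of a recursive relation is recursively enumerable: the set of
-- x with F(n, x) = 0 for some n is the domain of  x ↦ μn. F(n, x) = 0.
projection-RE : (F : Fun 2) → RE (λ x → ∃ λ n → fn F (n ∷ x ∷ []) ≡ 0)
projection-RE F = mu (code F) , λ x → search x , λ { (y , e-mu found _) → y , Eval-deterministic (computes F _) found }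
  where
  search : ∀ x → (∃ λ n → fn F (n ∷ x ∷ []) ≡ 0) → ∃ λ y → Eval (mu (code F)) (x ∷ []) y
  search x (n , zero-at-n) with least-witness (λ m → fn F (m ∷ x ∷ []) ≟ 0) zero-at-n
  ... | m , zero-at-m , nonzero-below =
    m , e-mu (subst (Eval (code F) _) zero-at-m (computes F _))
             (λ z z<m → pred (fn F (z ∷ x ∷ [])) ,
                        subst (Eval (code F) _) (sym (suc-pred _ {{≢-nonZero (nonzero-below z z<m)}})) (computes F _))

RE-resp : ∀ {A B : Pred ℕ 0ℓ} → (∀ x → A x → B x) → (∀ x → B x → A x) → RE A → RE B
RE-resp A⊆B B⊆A (f , domain) = f , λ x → (λ Bx → proj₁ (domain x) (B⊆A x Bx)) , (λ def → A⊆B x (proj₂ (domain x) def))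

-- The diagonal halting sets.  start e runs program number e on input e, and
-- Halts j e says that this run halts with result j.

start : ℕ → ℕ
start e = evalState e (cons e 0) 0

Halts : ℕ → Pred ℕ 0ℓ
Halts j e = start e ↠ haltState j

self-application-halts : ∀ (c : PRCode 1) {y} → Eval c (enc c ∷ []) y → Halts y (enc c)
self-application-halts c {y} ev = eval-runs ev 0 ⨾ ↠-step (step-return-empty y)

-- The machine's result is unique, since a halting state is never left.
halted-stays : ∀ k y → iterate k (haltState y) ≡ haltState y
halted-stays zero    y = refl
halted-stays (suc k) y = trans (cong step (halted-stays k y)) (step-halt y)

halted-later : ∀ {n m s y} → n ≤ m → iterate n s ≡ haltState y → iterate m s ≡ haltState y
halted-later {n} {m} {s} {y} n≤m halted = begin
  iterate m s                   ≡⟨ cong (λ k → iterate k s) (sym (m∸n+n≡m n≤m)) ⟩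
  iterate (m ∸ n + n) s         ≡⟨ iterate-+ (m ∸ n) n s ⟩
  iterate (m ∸ n) (iterate n s) ≡⟨ cong (iterate (m ∸ n)) halted ⟩
  iterate (m ∸ n) (haltState y) ≡⟨ halted-stays (m ∸ n) y ⟩
  haltState y                   ∎
  where open ≡-Reasoning

Halts-unique : ∀ {i j e} → Halts i e → Halts j e → i ≡ j
Halts-unique {i} {j} (n , halts-i) (m , halts-j) with ≤-total n m
... | inj₁ n≤m = pair-injective₂ (trans (sym (halted-later n≤m halts-i)) halts-j)
... | inj₂ m≤n = pair-injective₂ (trans (sym halts-i) (halted-later m≤n halts-j))

-- Whether the run on e is in state haltState j after n steps is decided by a
-- recursive function, kept opaque so that its (large) term is never unfolded
-- outside the two lemmas describing it.
opaque
  runF : Fun 2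
  runF = recFun (termFun (evalStateᵗ (var (# 0)) (consᵗ (var (# 0)) (lit 0)) (lit 0)))
                (termFun (app stepF (var (# 1) ∷ [])))

  run-graph : ∀ n e → fn runF (n ∷ e ∷ []) ≡ iterate n (start e)
  run-graph zero    e = refl
  run-graph (suc n) e = cong step (run-graph n e)

  haltCheckF : ℕ → Fun 2
  haltCheckF j = termFun (ifzᵗ (distᵗ (app runF (var (# 0) ∷ var (# 1) ∷ [])) (haltStateᵗ (lit j))) (lit 0) (lit 1))

  haltCheck-run : ∀ j n e → fn (haltCheckF j) (n ∷ e ∷ []) ≡ ifz (dist (iterate n (start e)) (haltState j)) 0 1
  haltCheck-run j n e = cong (λ s → ifz (dist s (haltState j)) 0 1) (run-graph n e)

ifz-zero-one : ∀ c → ifz c 0 1 ≡ 0 → c ≡ 0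
ifz-zero-one zero    _ = refl
ifz-zero-one (suc c) ()

haltCheck-sound : ∀ j n e → fn (haltCheckF j) (n ∷ e ∷ []) ≡ 0 → iterate n (start e) ≡ haltState j
haltCheck-sound j n e check = dist≡0⇒≡ (ifz-zero-one _ (trans (sym (haltCheck-run j n e)) check))

haltCheck-complete : ∀ j n e → iterate n (start e) ≡ haltState j → fn (haltCheckF j) (n ∷ e ∷ []) ≡ 0
haltCheck-complete j n e halted = begin
  fn (haltCheckF j) (n ∷ e ∷ [])                     ≡⟨ haltCheck-run j n e ⟩
  ifz (dist (iterate n (start e)) (haltState j)) 0 1 ≡⟨ cong (λ s → ifz (dist s (haltState j)) 0 1) halted ⟩
  ifz (dist (haltState j) (haltState j)) 0 1         ≡⟨ cong (λ c → ifz c 0 1) (dist-self (haltState j)) ⟩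
  0                                                  ∎
  where open ≡-Reasoning

Halts-RE : ∀ j → RE (Halts j)
Halts-RE j = RE-resp (λ e (n , check) → n , haltCheck-sound j n e check)
                     (λ e (n , halted) → n , haltCheck-complete j n e halted)
                     (projection-RE (haltCheckF j))

RecursivelyInseparable : Pred ℕ 0ℓ → Pred ℕ 0ℓ → Set₁
RecursivelyInseparable A B = ∀ (X : Pred ℕ 0ℓ) → Recursive X → (∀ n → A n → X n) → (∀ n → B n → ¬ X n) → ⊥

-- Diagonalisation: a decision procedure f for X is run on its own number.
Halts-inseparable : RecursivelyInseparable (Halts 0) (Halts 1)
Halts-inseparable X (f , decides) H₀⊆X H₁∩X=∅ with decides (enc f)
... | inj₁ (in-X , ev1)  = H₁∩X=∅ (enc f) (self-application-halts f ev1) in-X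
... | inj₂ (not-X , ev0) = not-X (H₀⊆X (enc f) (self-application-halts f ev0))

Recursive-preimage : ∀ {A : Pred ℕ 0ℓ} {g : ℕ → ℕ} → Recursive A → RecursiveFun g → Recursive (λ n → A (g n))
Recursive-preimage {g = g} (d , decides) (c , computes-g) =
  comp d (c ∷ []) , λ n → Sum.map (Product.map₂ (through n)) (Product.map₂ (through n)) (decides (g n))
  where
  through : ∀ n {b} → Eval d (g n ∷ []) b → Eval (comp d (c ∷ [])) (n ∷ []) b
  through n ev = e-comp (computes-g n ∷ []) ev

-- The logical core: T separates any disjoint r.e. pair A, B by the Rosser
-- sentences φₙ, and so does every strengthening S of T.  If S is consistent,
-- X = {n | S ⊢ φₙ} contains A and avoids B; it is recursive if S is decidable,
-- because ⌜φₙ⌝ is a recursive function of n.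
Rosser-no-decidable-strengthening :
  (𝓛 : Language) (𝔏 : Logic 𝓛) (T : Theory 𝓛) → RosserIn 𝓛 𝔏 T →
  ∀ {A B} → RE A → RE B → (∀ n → A n → B n → ⊥) → RecursivelyInseparable A B →
  ∀ (S : Theory 𝓛) → Strengthens 𝓛 𝔏 S T → ConsistentIn 𝓛 𝔏 S → ¬ DecidableIn 𝓛 𝔏 S
Rosser-no-decidable-strengthening 𝓛 𝔏 T rosser {A} {B} A-RE B-RE disjoint inseparable S S⊒T S-consistent S-decidable
  with rosser A B A-RE B-RE disjoint
... | φ , σ , code-recursive , A-proves , B-refutes =
  inseparable X (Recursive-preimage S-decidable code-recursive) A⊆X B∩X=∅
  where
  open Language 𝓛 using (⌜_⌝; ⌜⌝-inj)
  open Logic 𝔏 using (cut)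

  X : Pred ℕ 0ℓ
  X n = CodesOfConsequences 𝓛 𝔏 S ⌜ φ n ⌝

  A⊆X : ∀ n → A n → X n
  A⊆X n An = φ n , refl , cut T S (φ n) (A-proves n An) S⊒T

  B∩X=∅ : ∀ n → B n → ¬ X n
  B∩X=∅ n Bn (ψ , ⌜ψ⌝≡⌜φn⌝ , S⊢ψ) with ⌜⌝-inj ⌜ψ⌝≡⌜φn⌝
  ... | refl = S-consistent (φ n , σ n , S⊢ψ , cut T S _ (B-refutes n Bn) S⊒T)

mainTheorem6 : (𝓛 : Language) (𝔏 : Logic 𝓛) (T : Theory 𝓛) →
    ConsistentIn 𝓛 𝔏 T → RosserIn 𝓛 𝔏 T → EssentiallyUndecidableIn 𝓛 𝔏 T
mainTheorem6 𝓛 𝔏 T consistent rosser =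
  consistent ,
  Rosser-no-decidable-strengthening 𝓛 𝔏 T rosser (Halts-RE 0) (Halts-RE 1)
    (λ e halts-0 halts-1 → 0≢1+n (Halts-unique halts-0 halts-1)) Halts-inseparable
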